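{- Each $(\mathbb{Z},4)$-Ramsey ultrafilter $\mathcal{U}$ on $\mathbb{Z}$ is selective.
   Context: An ultrafilter is free if it is non-principal. For $n\geqslant 2$, $[\mathbb{Z}]^n$ denotes the set of $n$-element subsets of $\mathbb{Z}$, and $\mathbb{Z}$ acts on itself by translations. A coloring $\chi:[\mathbb{Z}]^n\to\{0,1\}$ is $\mathbb{Z}$-invariant if $\chi(\{x_1,\ldots,x_n\})=\chi(\{g+x_1,\ldots,g+x_n\})$ for all $\{x_1,\ldots,x_n\}\in[\mathbb{Z}]^n$ and $g\in\mathbb{Z}$. A free ultrafilter $\mathcal{U}$ on $\mathbb{Z}$ is $(\mathbb{Z},n)$-Ramsey if, for every $\mathbb{Z}$-invariant coloring $\chi:[\mathbb{Z}]^n\to\{0,1\}$, there exists $U\in\mathcal{U}$ such that $\chi$ is constant on $[U]^n$. A free ultrafilter $\mathcal{U}$ on an infinite set $X$ is selective if, for any partition $\mathcal{P}$ of $X$, either one cell of $\mathcal{P}$ is a member of $\mathcal{U}$, or some member of $\mathcal{U}$ meets each cell of $\mathcal{P}$ in at most one point. -}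

module Defs where

open import Data.Bool.Base using (Bool)
open import Data.Integer.Base using (ℤ; _+_; _<_)
open import Data.Integer.Properties using (+-monoʳ-<)
open import Data.Nat.Base using (ℕ)
open import Data.Product.Base using (∃; ∃-syntax; _×_)
open import Data.Sum.Base using (_⊎_)
open import Data.Vec.Base using (Vec; map)
open import Data.Vec.Relation.Unary.All using (All)
import Data.Vec.Relation.Unary.Linked as Linked
open Linked using (Linked)
open import Data.Vec.Relation.Unary.Linked.Properties using (map⁺)
open import Function.Bundles using (_⇔_)
open import Level using (Level; 0ℓ; _⊔_) renaming (suc to lsuc)
open import Relation.Binary.PropositionalEquality.Core using (_≡_)
open import Relation.Nullary.Negation.Core using (¬_)
open import Relation.Unary
  using (Pred; _∈_; _⊆_; _∩_; ∁; U; _≬_; _≐_; Satisfiable)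

private
  variable
    ℓ : Level

Subset : Set → Set₁
Subset X = Pred X 0ℓ

Family : Set → (ℓ : Level) → Set (lsuc 0ℓ ⊔ lsuc ℓ)
Family X ℓ = Pred (Subset X) ℓ

-- A filter is a family of nonempty sets, nonemptiness being read as
-- "has an element".  Together with `ultra`, applied to constant predicates,
-- `proper` yields excluded middle for Set, so a theorem about ultrafilters
-- in this sense is the classical theorem with no separate classical axiom.
record IsUltrafilter {X : Set} (𝒰 : Family X ℓ) : Set (lsuc 0ℓ ⊔ ℓ) where
  field
    proper : ∀ {A} → A ∈ 𝒰 → Satisfiable A
    whole  : U ∈ 𝒰
    upward : ∀ {A B} → A ⊆ B → A ∈ 𝒰 → B ∈ 𝒰
    meet   : ∀ {A B} → A ∈ 𝒰 → B ∈ 𝒰 → (A ∩ B) ∈ 𝒰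
    ultra  : ∀ A → A ∈ 𝒰 ⊎ ∁ A ∈ 𝒰

IsPrincipal : {X : Set} → Family X ℓ → Set (lsuc 0ℓ ⊔ ℓ)
IsPrincipal 𝒰 = ∃[ x ] (∀ A → A ∈ 𝒰 ⇔ x ∈ A)

record IsFreeUltrafilter {X : Set} (𝒰 : Family X ℓ) : Set (lsuc 0ℓ ⊔ ℓ) where
  field
    isUltrafilter : IsUltrafilter 𝒰
    nonPrincipal  : ¬ IsPrincipal 𝒰

record IsPartition {X : Set} (𝒫 : Family X ℓ) : Set (lsuc 0ℓ ⊔ ℓ) where
  field
    nonempty : ∀ {C} → C ∈ 𝒫 → Satisfiable C
    covers   : ∀ x → ∃[ C ] (C ∈ 𝒫 × x ∈ C)
    disjoint : ∀ {C D} → C ∈ 𝒫 → D ∈ 𝒫 → C ≬ D → C ≐ D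

MeetsInAtMostOnePoint : {X : Set} → Subset X → Subset X → Set
MeetsInAtMostOnePoint A C = ∀ {x y} → x ∈ A ∩ C → y ∈ A ∩ C → x ≡ y

-- The level p bounds the families of sets that count as partitions.
record IsSelective {X : Set} (p : Level) (𝒰 : Family X ℓ)
       : Set (lsuc 0ℓ ⊔ lsuc p ⊔ ℓ) where
  field
    isFreeUltrafilter : IsFreeUltrafilter 𝒰
    selective : (𝒫 : Family X p) → IsPartition 𝒫 →
      (∃[ C ] (C ∈ 𝒫 × C ∈ 𝒰)) ⊎
      (∃[ A ] (A ∈ 𝒰 × (∀ C → C ∈ 𝒫 → MeetsInAtMostOnePoint A C)))

-- An n-element subset of ℤ is given by its increasing enumeration, which is
-- unique; so functions on [ℤ]^ n are exactly functions of the subset.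
record [ℤ]^_ (n : ℕ) : Set where
  constructor ⟨_,_⟩
  field
    elements    : Vec ℤ n
    .increasing : Linked _<_ elements

open [ℤ]^_ public

[_]^_ : Subset ℤ → (n : ℕ) → Pred ([ℤ]^ n) 0ℓ
([ A ]^ n) s = All (_∈ A) (elements s)

translate : ∀ {n} → ℤ → [ℤ]^ n → [ℤ]^ n
translate g ⟨ xs , inc ⟩ =
  ⟨ map (g +_) xs , map⁺ (Linked.map (+-monoʳ-< g) inc) ⟩

Coloring : ℕ → Set
Coloring n = [ℤ]^ n → Bool

IsInvariant : ∀ {n} → Coloring n → Set
IsInvariant χ = ∀ g s → χ s ≡ χ (translate g s)

IsConstantOn : ∀ {n} → Coloring n → Pred ([ℤ]^ n) 0ℓ → Set
IsConstantOn χ S = ∃[ c ] (∀ s → s ∈ S → χ s ≡ c)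

record IsRamsey (n : ℕ) (𝒰 : Family ℤ ℓ) : Set (lsuc 0ℓ ⊔ ℓ) where
  field
    isFreeUltrafilter : IsFreeUltrafilter 𝒰
    ramsey : (χ : Coloring n) → IsInvariant χ →
      ∃[ A ] (A ∈ 𝒰 × IsConstantOn χ ([ A ]^ n))

{-# OPTIONS --safe #-}

-- A pair in a Sidon set A is determined by its difference, so every colouring
-- of [A]² extends to a ℤ-invariant colouring of [ℤ]².  Invariant Ramseyness
-- for quadruples provides a Sidon set A in the ultrafilter (the equations
-- x₂ - x₁ = x₄ - x₃ and x₂ - x₁ = x₃ - x₂ cannot hold throughout an infinite
-- set, hence fail throughout some member), and it passes to pairs by adding
-- dummy points at the end of ℤ where the ultrafilter is concentrated.  Apply
-- it to the colouring "both points lie in the same cell" of [A]².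
module Submission where

open import Defs
open import Data.Bool.Base using (Bool; true; false)
open import Data.Empty using (⊥-elim)
open import Data.Integer.Base
  using (ℤ; +_; -[1+_]; _+_; _-_; _<_; _≤_; -<+; -<-; +<+; 0ℤ; ∣_∣)
open import Data.Integer.Properties
open import Data.Integer.Tactic.RingSolver using (solve-∀)
import Data.Nat.Base as ℕ
import Data.Nat.Properties as ℕ
open import Data.Product.Base using (∃-syntax; _×_; _,_; proj₁; proj₂)
open import Data.Sum.Base as Sum using (_⊎_; inj₁; inj₂)
open import Data.Vec.Base using ([]; _∷_)
open import Data.Vec.Relation.Unary.All using ([]; _∷_)
open import Data.Vec.Relation.Unary.Linked using ([-]; _∷_)
open import Function.Base using (_∘_; case_of_)
open import Function.Bundles using (mk⇔)
open import Level using (Level)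
open import Relation.Binary.Definitions using (tri<; tri≈; tri>)
open import Relation.Binary.PropositionalEquality
  using (_≡_; _≢_; refl; sym; trans; cong; subst₂)
open import Relation.Nullary.Decidable.Core using (Dec; yes; no; does)
open import Relation.Nullary.Negation.Core using (¬_)
open import Relation.Unary using (_∈_; _⊆_; _∩_; ∁)

private
  variable
    ℓ : Level
    a b x y : ℤ

-- Arithmetic of differences.

translate-difference : ∀ g x y → (g + y) - (g + x) ≡ y - x
translate-difference = solve-∀

sum-of-difference : ∀ x y → (y - x) + x ≡ y
sum-of-difference = solve-∀

difference-cancelʳ : ∀ x → a - x ≡ b - x → a ≡ b
difference-cancelʳ {a} {b} x e =
  trans (sym (sum-of-difference x a))
    (trans (cong (_+ x) e) (sum-of-difference x b))

equal-differences-< : b - a ≡ y - x → a < x → b < y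
equal-differences-< {b} {a} {y} {x} e a<x =
  subst₂ _<_ (sum-of-difference a b)
    (trans (cong (_+ x) e) (sum-of-difference x y)) (+-monoʳ-< (b - a) a<x)

-- Adding `x - b` to both sides telescopes.
equal-differences-swap : b - a ≡ y - x → x - a ≡ y - b
equal-differences-swap {b} {a} {y} {x} e =
  trans (shift a b x) (trans (cong (_+ (x - b)) e) (sym (shift′ b x y)))
  where
  shift : ∀ a b x → x - a ≡ (b - a) + (x - b)
  shift = solve-∀
  shift′ : ∀ b x y → y - b ≡ (y - x) + (x - b)
  shift′ = solve-∀

-- Sidon sets.

IsSidon : Subset ℤ → Set
IsSidon A = ∀ {a b x y} → a ∈ A → b ∈ A → x ∈ A → y ∈ A →
  a < b → x < y → b - a ≡ y - x → a ≡ x × b ≡ y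

-- Take two increasing pairs with equal differences and, unless their left ends agree, let `a < x`.
-- The pairs are then separated, touching or interleaved: touching pairs form a three-term
-- progression, the others a quadruple with equal outer gaps.
isSidon : {A : Subset ℤ} →
  (∀ {w x y} → w ∈ A → x ∈ A → y ∈ A → w < x → x < y → x - w ≢ y - x) →
  (∀ {w x y z} → w ∈ A → x ∈ A → y ∈ A → z ∈ A →
    w < x → x < y → y < z → x - w ≢ z - y) →
  IsSidon A
isSidon {A} no₃ no₄ {a} {b} {x} {y} a∈ b∈ x∈ y∈ a<b x<y e =
  case <-cmp a x of λ where
    (tri< a<x _ _) → ⊥-elim (unshifted a∈ b∈ x∈ y∈ a<b x<y e a<x)
    (tri≈ _ refl _) → refl , difference-cancelʳ a e
    (tri> _ _ x<a) → ⊥-elim (unshifted x∈ y∈ a∈ b∈ x<y a<b (sym e) x<a)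
  where
  unshifted : ∀ {a b x y} → a ∈ A → b ∈ A → x ∈ A → y ∈ A →
    a < b → x < y → b - a ≡ y - x → ¬ a < x
  unshifted {a} {b} {x} {y} a∈ b∈ x∈ y∈ a<b x<y e a<x with <-cmp b x
  ... | tri< b<x _ _ = no₄ a∈ b∈ x∈ y∈ a<b b<x x<y e
  ... | tri≈ _ refl _ = no₃ a∈ b∈ y∈ a<b x<y e
  -- Interleaved, `a < x < b < y`: exchanging `b` and `x` turns the equation into one between the
  -- outer gaps.
  ... | tri> _ _ x<b =
    no₄ a∈ x∈ b∈ y∈ a<x x<b (equal-differences-< {b} {a} {y} {x} e a<x)
      (equal-differences-swap {b} {a} {y} {x} e)

-- Unbounded sets of integers.

UnboundedAbove UnboundedBelow : Subset ℤ → Set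
UnboundedAbove A = ∀ c → ∃[ x ] (x ∈ A × c < x)
UnboundedBelow A = ∀ c → ∃[ x ] (x ∈ A × x < c)

-- Five points carry two quadruples that differ only in their last point, as the exclusion of
-- parallelograms requires.
HasIncreasing₅ : Subset ℤ → Set
HasIncreasing₅ A = ∃[ v ] ∃[ w ] ∃[ x ] ∃[ y ] ∃[ z ]
  ((v ∈ A × w ∈ A × x ∈ A × y ∈ A × z ∈ A) × v < w × w < x × x < y × y < z)

unbounded⇒increasing₅ : ∀ {A} → UnboundedAbove A ⊎ UnboundedBelow A →
  HasIncreasing₅ A
unbounded⇒increasing₅ (inj₁ above) =
  let v , v∈ , _   = above 0ℤ
      w , w∈ , v<w = above v
      x , x∈ , w<x = above w
      y , y∈ , x<y = above x
      z , z∈ , y<z = above y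
  in v , w , x , y , z , (v∈ , w∈ , x∈ , y∈ , z∈) , v<w , w<x , x<y , y<z
unbounded⇒increasing₅ (inj₂ below) =
  let z , z∈ , _   = below 0ℤ
      y , y∈ , y<z = below z
      x , x∈ , x<y = below y
      w , w∈ , w<x = below x
      v , v∈ , v<w = below w
  in v , w , x , y , z , (v∈ , w∈ , x∈ , y∈ , z∈) , v<w , w<x , x<y , y<z

-- Free ultrafilters and the end of the line at which they concentrate.

module UltrafilterProperties {X : Set} {𝒰 : Family X ℓ}
    (isUltrafilter : IsUltrafilter 𝒰) where

  open IsUltrafilter isUltrafilter

  excluded-middle : (P : Set) → Dec P
  excluded-middle P with ultra (λ _ → P)
  ... | inj₁ P∈ = yes (proj₂ (proper P∈))
  ... | inj₂ ¬P∈ = no (proj₂ (proper ¬P∈))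

  ∁-singleton : ¬ IsPrincipal 𝒰 → ∀ x → ∁ (_≡ x) ∈ 𝒰
  ∁-singleton nonPrincipal x with ultra (_≡ x)
  ... | inj₂ ∁∈ = ∁∈
  ... | inj₁ ∈𝒰 = ⊥-elim (nonPrincipal (x , λ A → mk⇔
    (λ A∈ → case proper (meet A∈ ∈𝒰) of λ where (_ , y∈A , refl) → y∈A)
    (λ x∈A → upward (λ where refl → x∈A) ∈𝒰)))

module FreeUltrafilterProperties {𝒰 : Family ℤ ℓ}
    (free : IsFreeUltrafilter 𝒰) where

  open IsFreeUltrafilter free public
  open IsUltrafilter isUltrafilter public
  open UltrafilterProperties isUltrafilter public

  remove : ∀ {A} x → A ∈ 𝒰 → (A ∩ ∁ (_≡ x)) ∈ 𝒰
  remove x A∈ = meet A∈ (∁-singleton nonPrincipal x)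

  -- The ultrafilter decides between nonnegative and negative integers. As single points may be
  -- discarded, the chosen ray moves outwards one integer at a time, past any `c`.
  rays : (∀ c → (c <_) ∈ 𝒰) ⊎ (∀ c → (_< c) ∈ 𝒰)
  rays with ultra (0ℤ ≤_)
  ... | inj₁ nonneg = inj₁ λ c →
      upward (λ le → <-≤-trans (n<1+∣n∣ c) le) (ascend (ℕ.suc ∣ c ∣))
    where
    n<1+∣n∣ : ∀ i → i < + ℕ.suc ∣ i ∣
    n<1+∣n∣ (+ n) = +<+ (ℕ.n<1+n n)
    n<1+∣n∣ -[1+ _ ] = -<+
    ascend : ∀ n → (+ n ≤_) ∈ 𝒰
    ascend ℕ.zero = nonneg
    ascend (ℕ.suc n) =
      upward (λ (le , ne) → i<j⇒suc[i]≤j (≤∧≢⇒< le (ne ∘ sym)))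
        (remove (+ n) (ascend n))
  ... | inj₂ negative = inj₂ λ c →
      -- The descent starts from -1, not 0, so `∣ c ∣` steps already lead strictly below `c`.
      upward (λ le → ≤-<-trans le (-[1+∣n∣]<n c)) (descend ∣ c ∣)
    where
    -[1+∣n∣]<n : ∀ i → -[1+ ∣ i ∣ ] < i
    -[1+∣n∣]<n (+ _) = -<+
    -[1+∣n∣]<n -[1+ n ] = -<- (ℕ.n<1+n n)
    descend : ∀ n → (_≤ -[1+ n ]) ∈ 𝒰
    descend ℕ.zero = upward (λ 0≰x → i<j⇒i≤pred[j] (≰⇒> 0≰x)) negative
    descend (ℕ.suc n) =
      upward (λ (le , ne) → i<j⇒i≤pred[j] (≤∧≢⇒< le ne))
        (remove -[1+ n ] (descend n))

  -- One direction serves all members at once, so it can be fixed before a homogeneous set is known.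
  unbounded : (∀ {A} → A ∈ 𝒰 → UnboundedAbove A) ⊎
              (∀ {A} → A ∈ 𝒰 → UnboundedBelow A)
  unbounded = Sum.map (λ ray {_} A∈ c → proper (meet A∈ (ray c)))
                      (λ ray {_} A∈ c → proper (meet A∈ (ray c))) rays

  increasing₅ : ∀ {A} → A ∈ 𝒰 → HasIncreasing₅ A
  increasing₅ {A} A∈ =
    unbounded⇒increasing₅ {A}
      (Sum.map (λ above → above A∈) (λ below → below A∈) unbounded)

-- Homogeneous sets for properties of gaps.

AllPairs : (ℤ → Set) → Subset ℤ → Set
AllPairs P A = ∀ {x y} → x ∈ A → y ∈ A → x < y → P (y - x)

AllTriples : (ℤ → ℤ → Set) → Subset ℤ → Set
AllTriples P A = ∀ {w x y} → w ∈ A → x ∈ A → y ∈ A → w < x → x < y →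
  P (x - w) (y - x)

AllQuadruples : (ℤ → ℤ → ℤ → Set) → Subset ℤ → Set
AllQuadruples P A = ∀ {w x y z} → w ∈ A → x ∈ A → y ∈ A → z ∈ A →
  w < x → x < y → y < z → P (x - w) (y - x) (z - y)

-- An invariant colouring of [ℤ]⁴ is a function of the three consecutive
-- differences.
differenceColoring : (ℤ → ℤ → ℤ → Bool) → Coloring 4
differenceColoring f ⟨ w ∷ x ∷ y ∷ z ∷ [] , _ ⟩ = f (x - w) (y - x) (z - y)

differenceColoring-invariant : ∀ f → IsInvariant (differenceColoring f)
differenceColoring-invariant f g ⟨ w ∷ x ∷ y ∷ z ∷ [] , _ ⟩
  rewrite translate-difference g w x
        | translate-difference g x y
        | translate-difference g y z = refl

module RamseyProperties {𝒰 : Family ℤ ℓ} (isRamsey : IsRamsey 4 𝒰) where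

  open IsRamsey isRamsey
  open FreeUltrafilterProperties isFreeUltrafilter

  ramsey₄ : (P : ℤ → ℤ → ℤ → Set) → ∃[ A ] (A ∈ 𝒰 ×
    (AllQuadruples P A ⊎ AllQuadruples (λ a b c → ¬ P a b c) A))
  -- Excluded middle turns `P` into a Boolean colouring of the gaps; its two colours give the two
  -- alternatives.
  ramsey₄ P with ramsey _ (differenceColoring-invariant
    (λ a b c → does (excluded-middle (P a b c))))
  ... | A , A∈ , true , constant = A , A∈ , inj₁
    λ w∈ x∈ y∈ z∈ w<x x<y y<z → does-true (excluded-middle _)
      (constant ⟨ _ , w<x ∷ x<y ∷ y<z ∷ [-] ⟩ (w∈ ∷ x∈ ∷ y∈ ∷ z∈ ∷ []))
    where
    does-true : ∀ {Q : Set} (d : Dec Q) → does d ≡ true → Q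
    does-true (yes q) _ = q
  ... | A , A∈ , false , constant = A , A∈ , inj₂
    λ w∈ x∈ y∈ z∈ w<x x<y y<z → does-false (excluded-middle _)
      (constant ⟨ _ , w<x ∷ x<y ∷ y<z ∷ [-] ⟩ (w∈ ∷ x∈ ∷ y∈ ∷ z∈ ∷ []))
    where
    does-false : ∀ {Q : Set} (d : Dec Q) → does d ≡ false → ¬ Q
    does-false (no ¬q) _ = ¬q

  ramsey₃ : (P : ℤ → ℤ → Set) → ∃[ A ] (A ∈ 𝒰 ×
    (AllTriples P A ⊎ AllTriples (λ a b → ¬ P a b) A))
  ramsey₃ P with unbounded
  ... | inj₁ above =
    -- The colouring reads the first two gaps, so any point of `A` beyond `y` completes a triple
    -- without affecting its colour. `extend` takes any `Q` because it serves both `P` and its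
    -- negation.
    let A , A∈ , homogeneous = ramsey₄ (λ a b _ → P a b)
        extend : ∀ Q → AllQuadruples (λ a b _ → Q a b) A → AllTriples Q A
        extend _ q w∈ x∈ y∈ w<x x<y =
          let _ , z∈ , y<z = above A∈ _ in q w∈ x∈ y∈ z∈ w<x x<y y<z
    in A , A∈ , Sum.map (extend P) (extend λ a b → ¬ P a b) homogeneous
  ... | inj₂ below =
    -- The completing point now lies below `w`, so the last two gaps are read.
    let A , A∈ , homogeneous = ramsey₄ (λ _ a b → P a b)
        extend : ∀ Q → AllQuadruples (λ _ a b → Q a b) A → AllTriples Q A
        extend _ q w∈ x∈ y∈ w<x x<y =
          let _ , v∈ , v<w = below A∈ _ in q v∈ w∈ x∈ y∈ v<w w<x x<y
    in A , A∈ , Sum.map (extend P) (extend λ a b → ¬ P a b) homogeneous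

  ramsey₂ : (P : ℤ → Set) → ∃[ A ] (A ∈ 𝒰 ×
    (AllPairs P A ⊎ AllPairs (λ a → ¬ P a) A))
  ramsey₂ P with unbounded
  ... | inj₁ above =
    let A , A∈ , homogeneous = ramsey₃ (λ a _ → P a)
        extend : ∀ Q → AllTriples (λ a _ → Q a) A → AllPairs Q A
        extend _ q x∈ y∈ x<y =
          let _ , z∈ , y<z = above A∈ _ in q x∈ y∈ z∈ x<y y<z
    in A , A∈ , Sum.map (extend P) (extend λ a → ¬ P a) homogeneous
  ... | inj₂ below =
    let A , A∈ , homogeneous = ramsey₃ (λ _ a → P a)
        extend : ∀ Q → AllTriples (λ _ a → Q a) A → AllPairs Q A
        extend _ q x∈ y∈ x<y =
          let _ , w∈ , w<x = below A∈ _ in q w∈ x∈ y∈ w<x x<y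
    in A , A∈ , Sum.map (extend P) (extend λ a → ¬ P a) homogeneous

  -- If all triples were progressions, two points would determine the third.
  ∃-without-progressions : ∃[ A ] (A ∈ 𝒰 × AllTriples _≢_ A)
  ∃-without-progressions with ramsey₃ _≡_
  ... | A , A∈ , inj₂ distinct = A , A∈ , distinct
  ... | A , A∈ , inj₁ equal =
    let v , w , x , y , z , (v∈ , w∈ , x∈ , y∈ , z∈) , v<w , w<x , x<y , y<z =
          increasing₅ A∈
        e = trans (sym (equal v∈ w∈ x∈ v<w w<x))
                  (equal v∈ w∈ y∈ v<w (<-trans w<x x<y))
    in ⊥-elim (<⇒≢ x<y (difference-cancelʳ w e))

  -- If the outer gaps always agreed, the first three points of a quadruple would determine the
  -- fourth.
  ∃-without-parallelograms :
    ∃[ A ] (A ∈ 𝒰 × AllQuadruples (λ a _ c → a ≢ c) A)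
  ∃-without-parallelograms with ramsey₄ (λ a _ c → a ≡ c)
  ... | A , A∈ , inj₂ distinct = A , A∈ , distinct
  ... | A , A∈ , inj₁ equal =
    let v , w , x , y , z , (v∈ , w∈ , x∈ , y∈ , z∈) , v<w , w<x , x<y , y<z =
          increasing₅ A∈
        e = trans (sym (equal v∈ w∈ x∈ y∈ v<w w<x x<y))
                  (equal v∈ w∈ x∈ z∈ v<w w<x (<-trans x<y y<z))
    in ⊥-elim (<⇒≢ y<z (difference-cancelʳ x e))

  ∃-Sidon : ∃[ A ] (A ∈ 𝒰 × IsSidon A)
  ∃-Sidon =
    let A , A∈ , no₃ = ∃-without-progressions
        B , B∈ , no₄ = ∃-without-parallelograms
    in A ∩ B , meet A∈ B∈ , isSidon
         (λ w∈ x∈ y∈ → no₃ (proj₁ w∈) (proj₁ x∈) (proj₁ y∈))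
         (λ w∈ x∈ y∈ z∈ → no₄ (proj₂ w∈) (proj₂ x∈) (proj₂ y∈) (proj₂ z∈))

  ramsey-pairs : (R : ℤ → ℤ → Set) → ∃[ A ] (A ∈ 𝒰 ×
    ((∀ {x y} → x ∈ A → y ∈ A → x < y → R x y) ⊎
     (∀ {x y} → x ∈ A → y ∈ A → x < y → ¬ R x y)))
  ramsey-pairs R with ∃-Sidon
  -- Quantifying over the pairs of `A` transfers `R`, which may depend on position, to differences.
  ... | A , A∈ , sidon with ramsey₂ (λ d →
          ∃[ a ] ∃[ b ] (a ∈ A × b ∈ A × a < b × b - a ≡ d × R a b))
  ... | B , B∈ , inj₁ all = A ∩ B , meet A∈ B∈ , inj₁
    λ (x∈A , x∈B) (y∈A , y∈B) x<y →
      -- The witnessing pair is only known to lie in `A`; the Sidon property identifies it with `x`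
      -- and `y`.
      let _ , _ , a∈ , b∈ , a<b , e , r = all x∈B y∈B x<y
          a≡x , b≡y = sidon a∈ b∈ x∈A y∈A a<b x<y e
      in subst₂ R a≡x b≡y r
  ... | B , B∈ , inj₂ none = A ∩ B , meet A∈ B∈ , inj₂
    λ (x∈A , x∈B) (y∈A , y∈B) x<y r →
      none x∈B y∈B x<y (_ , _ , x∈A , y∈A , x<y , refl , r)

-- Partitions and selectivity.

module PartitionProperties {X : Set} {p : Level} {𝒫 : Family X p}
    (isPartition : IsPartition 𝒫) where

  open IsPartition isPartition

  -- Although `𝒫` has level `p`, membership in the cell chosen by `covers` is a `Set`, so excluded
  -- middle can turn it into a colour.
  cell : X → Subset X
  cell x = proj₁ (covers x)

  cell-∈ : ∀ x → cell x ∈ 𝒫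
  cell-∈ x = proj₁ (proj₂ (covers x))

  ∈-cell : ∀ x → x ∈ cell x
  ∈-cell x = proj₂ (proj₂ (covers x))

  -- `C` and the chosen cell share `x`, so they have the same elements.
  same-cell : ∀ {C x y} → C ∈ 𝒫 → x ∈ C → y ∈ C → y ∈ cell x
  same-cell C∈ x∈ y∈ =
    proj₁ (disjoint C∈ (cell-∈ _) (_ , x∈ , ∈-cell _)) y∈

corollary5 : {ℓ p : Level} (𝒰 : Family ℤ ℓ) → IsRamsey 4 𝒰 → IsSelective p 𝒰
corollary5 𝒰 isRamsey = record
  { isFreeUltrafilter = IsRamsey.isFreeUltrafilter isRamsey
  ; selective = λ 𝒫 isPartition →
      let open PartitionProperties isPartition in
      case ramsey-pairs (λ x y → y ∈ cell x) of λ where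
        (A , A∈ , inj₁ same) →
          let x , x∈ = proper A∈
              A⊆cell : A ⊆ cell x
              A⊆cell {y} y∈ = case <-cmp x y of λ where
                (tri< x<y _ _) → same x∈ y∈ x<y
                (tri≈ _ refl _) → ∈-cell x
                -- `same` speaks of increasing pairs only: here it puts `x` in the cell of `y`, and
                -- the membership has to be reversed.
                (tri> _ _ y<x) →
                  same-cell (cell-∈ y) (same y∈ x∈ y<x) (∈-cell y)
          in inj₁ (cell x , cell-∈ x , upward A⊆cell A∈)
        (A , A∈ , inj₂ distinct) → inj₂ (A , A∈ ,
          λ C C∈ {x} {y} (x∈A , x∈C) (y∈A , y∈C) → case <-cmp x y of λ where
            (tri< x<y _ _) →
              ⊥-elim (distinct x∈A y∈A x<y (same-cell C∈ x∈C y∈C))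
            (tri≈ _ x≡y _) → x≡y
            (tri> _ _ y<x) →
              ⊥-elim (distinct y∈A x∈A y<x (same-cell C∈ y∈C x∈C)))
  }
  where
  open RamseyProperties isRamsey
  open FreeUltrafilterProperties (IsRamsey.isFreeUltrafilter isRamsey)
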